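{- Let $b$ and $n\ge 2$ be positive integers and let $h(x)=h_{n-2}x^{n-2}+\cdots+h_1x+h_0$ be a polynomial with complex coefficients of degree at most $n-2$. Define the numbers $h_i'$ ($i\ge 0$) by \[ \Phi_b\left(\frac{h(x)}{(1-x)^n}\right)=\frac{\sum_{i\ge 0}h_i' x^i}{(1-x)^n}. \] Then for every $i\ge 0$, \[ h_i' = b^{n-1}\sum_{j=0}^{n-2} K_b(j,i)\,h_j, \] where $K_b$ is the transition matrix of the base $b$ carries chain for the addition of $n-1$ numbers.
   Context: Let $\mathcal{R}$ be the space of rational functions in $x$ with complex coefficients. Every $R\in\mathcal{R}$ has a Laurent expansion at $x=0$, $R(x)=\sum_{n\gg-\infty} a_n x^n$ (only finitely many nonzero coefficients with negative index). For a positive integer $b$, the map $\Phi_b:\mathcal{R}\to\mathcal{R}$ is defined by $\Phi_b(R(x))=\sum_{n\gg -\infty} a_{bn+(b-1)}x^n$. The base $b$ carries chain for the addition of $m$ numbers: when $m$ numbers are added in base $b$ with all digits chosen independently and uniformly from $\{0,1,\dots,b-1\}$, the successive carries (working from the right, starting from carry $0$) form a Markov chain; if the current carry is $c$ and the digits in the next column are $y_1,\dots,y_m$, the next carry is $\lfloor (c+y_1+\cdots+y_m)/b\rfloor$. Its transition matrix is \[ K_b(c,d)=\frac{1}{b^m}\,\#\{(y_1,\dots,y_m)\in\{0,\dots,b-1\}^m : \lfloor (c+y_1+\cdots+y_m)/b\rfloor = d\} \] for nonnegative integers $c,d$ (here $m=n-1$, and for carries $c\le n-2$ one has $K_b(c,d)=0$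 whenever $d\ge n-1$). -}

module Defs where

open import Algebra.Bundles using (CommutativeRing)
open import Algebra.Definitions using (Invertible)
open import Algebra.Structures using (IsCommutativeRing)
import Algebra.Properties.Group as GroupProperties
import Algebra.Properties.Ring as RingProperties
import Algebra.Solver.Ring.NaturalCoefficients.Default as SemiringSolver
open import Data.Fin.Base using (Fin; toℕ)
open import Data.Integer.Base as ℤ using (ℤ; +_; -[1+_])
import Data.Integer.Properties as ℤₚ
open import Data.Integer.Tactic.RingSolver
  using () renaming (solve-∀ to ℤ-solve-∀)
open import Data.List.Base as List
  using (List; []; _∷_; [_]; allFin; cartesianProductWith; filter; length)
open import Data.Nat.Base as ℕ using (ℕ; zero; suc; NonZero)
import Data.Nat.Properties as ℕₚ
open import Data.Product.Base using (_,_; _×_; proj₁; ∃)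
open import Data.Rational.Base as ℚ using (ℚ; 0ℚ; 1ℚ; ½)
import Data.Rational.Properties as ℚₚ
open import Data.Vec.Base as Vec using (Vec)
open import Level using (_⊔_; 0ℓ)
open import Relation.Binary.PropositionalEquality.Core as ≡
  using (_≡_; cong; subst; subst₂)
import Relation.Binary.Reasoning.Setoid as SetoidReasoning
open import Relation.Nullary.Decidable.Core using (dec⇒maybe)
open import Tactic.RingSolver using (solve-∀)
open import Tactic.RingSolver.Core.AlmostCommutativeRing
  using (AlmostCommutativeRing; fromCommutativeRing)

------------------------------------------------------------------------
-- Real numbers as Cauchy sequences of rationals

-- x ∼ y says that x m - y n tends to 0 as m and n independently tend to
-- infinity.  So x ∼ x says exactly that x is a Cauchy sequence, and for
-- Cauchy sequences x ∼ y says that x and y have the same limit.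

infix 4 _∼_

_∼_ : (ℕ → ℚ) → (ℕ → ℚ) → Set
x ∼ y = ∀ ε → 0ℚ ℚ.< ε →
  ∃ λ N → ∀ m n → N ℕ.≤ m → N ℕ.≤ n → ℚ.∣ x m ℚ.- y n ∣ ℚ.< ε

record ℝ : Set where
  constructor mkℝ
  field
    seq    : ℕ → ℚ
    cauchy : seq ∼ seq

open ℝ public

module ℝ-Properties where

  ℚ-ring : AlmostCommutativeRing 0ℓ 0ℓ
  ℚ-ring = fromCommutativeRing ℚₚ.+-*-commutativeRing
    (λ q → dec⇒maybe (0ℚ ℚₚ.≟ q))

  open import Data.Rational.Base
    using (_+_; _*_; -_; _-_; _<_; _≤_; ∣_∣; 1/_)

  private

    half : ∀ ε → ½ * ε + ½ * ε ≡ ε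
    half ε = ≡.trans (≡.sym (ℚₚ.*-distribʳ-+ ε ½ ½)) (ℚₚ.*-identityˡ ε)

    half-pos : ∀ {ε} → 0ℚ < ε → 0ℚ < ½ * ε
    half-pos {ε} 0<ε = subst (_< ½ * ε) (ℚₚ.*-zeroʳ ½) (ℚₚ.*-monoʳ-<-pos ½ 0<ε)

    ∣+∣< : ∀ p q {r s} → ∣ p ∣ < r → ∣ q ∣ < s → ∣ p + q ∣ < r + s
    ∣+∣< p q p<r q<s =
      ℚₚ.≤-<-trans (ℚₚ.∣p+q∣≤∣p∣+∣q∣ p q) (ℚₚ.+-mono-< p<r q<s)

    lhs≤ : ∀ M N {m} → M ℕ.⊔ N ℕ.≤ m → M ℕ.≤ m
    lhs≤ M N = ℕₚ.≤-trans (ℕₚ.m≤m⊔n M N)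

    rhs≤ : ∀ M N {m} → M ℕ.⊔ N ℕ.≤ m → N ℕ.≤ m
    rhs≤ M N = ℕₚ.≤-trans (ℕₚ.m≤n⊔m M N)

    ∣-∣-comm : ∀ p q → ∣ p - q ∣ ≡ ∣ q - p ∣
    ∣-∣-comm p q = ≡.trans (cong ∣_∣ (swap p q)) (ℚₚ.∣-p∣≡∣p∣ (q - p))
      where
      swap : ∀ p q → p - q ≡ - (q - p)
      swap = solve-∀ ℚ-ring

  ∼-sym : ∀ {x y} → x ∼ y → y ∼ x
  ∼-sym {x} {y} x∼y ε 0<ε = let N , f = x∼y ε 0<ε in
    N , λ m n N≤m N≤n → subst (_< ε) (∣-∣-comm (x n) (y m)) (f n m N≤n N≤m)

  private
    telescope : ∀ a b c → (a - b) + (b - c) ≡ a - c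
    telescope = solve-∀ ℚ-ring

  ∼-trans : ∀ {x y z} → x ∼ y → y ∼ z → x ∼ z
  ∼-trans {x} {y} {z} x∼y y∼z ε 0<ε =
    let M , f = x∼y (½ * ε) (half-pos 0<ε)
        N , g = y∼z (½ * ε) (half-pos 0<ε)
    in M ℕ.⊔ N , λ m n ≤m ≤n →
       subst₂ (λ u v → ∣ u ∣ < v) (telescope (x m) (y m) (z n)) (half ε)
         (∣+∣< (x m - y m) (y m - z n)
               (f m m (lhs≤ M N ≤m) (lhs≤ M N ≤m))
               (g m n (rhs≤ M N ≤m) (rhs≤ M N ≤n)))

  const-∼ : ∀ q → (λ _ → q) ∼ (λ _ → q)
  const-∼ q ε 0<ε =
    0 , λ _ _ _ _ → subst (_< ε) (≡.sym (cong ∣_∣ (ℚₚ.+-inverseʳ q))) 0<ε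

  +-∼ : ∀ {x x′ y y′} → x ∼ x′ → y ∼ y′ →
        (λ n → x n + y n) ∼ (λ n → x′ n + y′ n)
  +-∼ {x} {x′} {y} {y′} x∼x′ y∼y′ ε 0<ε =
    let M , f = x∼x′ (½ * ε) (half-pos 0<ε)
        N , g = y∼y′ (½ * ε) (half-pos 0<ε)
    in M ℕ.⊔ N , λ m n ≤m ≤n →
       subst₂ (λ u v → ∣ u ∣ < v)
         (rearrange (x m) (x′ n) (y m) (y′ n)) (half ε)
         (∣+∣< (x m - x′ n) (y m - y′ n)
               (f m n (lhs≤ M N ≤m) (lhs≤ M N ≤n))
               (g m n (rhs≤ M N ≤m) (rhs≤ M N ≤n)))
    where
    rearrange : ∀ a b c d → (a - b) + (c - d) ≡ (a + c) - (b + d)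
    rearrange = solve-∀ ℚ-ring

  neg-∼ : ∀ {x y} → x ∼ y → (λ n → - x n) ∼ (λ n → - y n)
  neg-∼ {x} {y} x∼y ε 0<ε = let N , f = x∼y ε 0<ε in
    N , λ m n N≤m N≤n →
      subst (_< ε)
        (≡.trans (≡.sym (ℚₚ.∣-p∣≡∣p∣ (x m - y n))) (cong ∣_∣ (rearrange (x m) (y n))))
        (f m n N≤m N≤n)
    where
    rearrange : ∀ a b → - (a - b) ≡ - a - - b
    rearrange = solve-∀ ℚ-ring

  private
    ∣∣+1-pos : ∀ p → 0ℚ < 1ℚ + ∣ p ∣
    ∣∣+1-pos p = subst (_< 1ℚ + ∣ p ∣) (ℚₚ.+-identityʳ 0ℚ)
      (ℚₚ.+-mono-<-≤ (ℚₚ.positive⁻¹ 1ℚ) (ℚₚ.0≤∣p∣ p))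

    bounded : ∀ {x y} → x ∼ y → ∃ λ B → 0ℚ < B ×
      (∃ λ N → ∀ m → N ℕ.≤ m → ∣ x m ∣ < B)
    bounded {x} {y} x∼y =
      let N , f = x∼y 1ℚ (ℚₚ.positive⁻¹ 1ℚ) in
      1ℚ + ∣ y N ∣ , ∣∣+1-pos (y N) , N , λ m N≤m →
        ℚₚ.≤-<-trans
          (subst (λ u → ∣ u ∣ ≤ ∣ x m - y N ∣ + ∣ y N ∣) (cancel (x m) (y N))
            (ℚₚ.∣p+q∣≤∣p∣+∣q∣ (x m - y N) (y N)))
          (ℚₚ.+-monoˡ-< ∣ y N ∣ (f m N N≤m ℕₚ.≤-refl))
      where
      cancel : ∀ a b → (a - b) + b ≡ a
      cancel = solve-∀ ℚ-ring

    quotient : ∀ {B ε} → 0ℚ < B → 0ℚ < ε →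
      ∃ λ δ → 0ℚ < δ × (∀ p q → ∣ p ∣ < B → ∣ q ∣ < δ → ∣ p * q ∣ < ε)
    quotient {B} {ε} 0<B 0<ε = δ , 0<δ , bound
      where
      instance
        B-pos : ℚ.Positive B
        B-pos = ℚ.positive 0<B
        B-nonZero : ℚ.NonZero B
        B-nonZero = ℚₚ.pos⇒nonZero B
        1/B-pos : ℚ.Positive (1/ B)
        1/B-pos = ℚₚ.1/pos⇒pos B
      δ = 1/ B * ε
      0<δ : 0ℚ < δ
      0<δ = subst (_< δ) (ℚₚ.*-zeroʳ (1/ B)) (ℚₚ.*-monoʳ-<-pos (1/ B) 0<ε)
      Bδ≡ε : B * δ ≡ ε
      Bδ≡ε = ≡.trans (≡.sym (ℚₚ.*-assoc B (1/ B) ε))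
        (≡.trans (cong (_* ε) (ℚₚ.*-inverseʳ B)) (ℚₚ.*-identityˡ ε))
      bound : ∀ p q → ∣ p ∣ < B → ∣ q ∣ < δ → ∣ p * q ∣ < ε
      bound p q p<B q<δ = subst₂ _<_ (≡.sym (ℚₚ.∣p*q∣≡∣p∣*∣q∣ p q)) Bδ≡ε
        (ℚₚ.≤-<-trans
          (ℚₚ.*-monoʳ-≤-nonNeg ∣ q ∣ {{ℚₚ.∣-∣-nonNeg q}} (ℚₚ.<⇒≤ p<B))
          (ℚₚ.*-monoʳ-<-pos B q<δ))

  *-∼ : ∀ {x x′ y y′} → x ∼ x′ → y ∼ y′ →
        (λ n → x n * y n) ∼ (λ n → x′ n * y′ n)
  *-∼ {x} {x′} {y} {y′} x∼x′ y∼y′ ε 0<ε =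
    let A , 0<A , K , x<A   = bounded {x} {x′} x∼x′
        B , 0<B , L , y′<B  = bounded {y′} {y} (∼-sym {y} {y′} y∼y′)
        δ , 0<δ , Aδ        = quotient 0<A (half-pos 0<ε)
        η , 0<η , Bη        = quotient 0<B (half-pos 0<ε)
        M , f = y∼y′ δ 0<δ
        N , g = x∼x′ η 0<η
    in (K ℕ.⊔ L) ℕ.⊔ (M ℕ.⊔ N) , λ m n ≤m ≤n →
       subst₂ (λ u v → ∣ u ∣ < v)
         (rearrange (x m) (x′ n) (y m) (y′ n)) (half ε)
         (∣+∣< (x m * (y m - y′ n)) (y′ n * (x m - x′ n))
           (Aδ (x m) (y m - y′ n)
               (x<A m (lhs≤ K L (lhs≤ (K ℕ.⊔ L) (M ℕ.⊔ N) ≤m)))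
               (f m n (lhs≤ M N (rhs≤ (K ℕ.⊔ L) (M ℕ.⊔ N) ≤m))
                      (lhs≤ M N (rhs≤ (K ℕ.⊔ L) (M ℕ.⊔ N) ≤n))))
           (Bη (y′ n) (x m - x′ n)
               (y′<B n (rhs≤ K L (lhs≤ (K ℕ.⊔ L) (M ℕ.⊔ N) ≤n)))
               (g m n (rhs≤ M N (rhs≤ (K ℕ.⊔ L) (M ℕ.⊔ N) ≤m))
                      (rhs≤ M N (rhs≤ (K ℕ.⊔ L) (M ℕ.⊔ N) ≤n)))))
    where
    rearrange : ∀ a b c d → a * (c - d) + d * (a - b) ≡ a * c - b * d
    rearrange = solve-∀ ℚ-ring

  pointwise : ∀ {x y} → y ∼ y → (∀ n → x n ≡ y n) → x ∼ y
  pointwise {x} {y} y∼y x≗y ε 0<ε = let N , f = y∼y ε 0<ε in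
    N , λ m n N≤m N≤n →
      subst (λ u → ∣ u - y n ∣ < ε) (≡.sym (x≗y m)) (f m n N≤m N≤n)

open ℝ-Properties

infix 4 _≈ℝ_

-- A record rather than a synonym, so that x and y can be inferred.
record _≈ℝ_ (x y : ℝ) : Set where
  constructor mk≈
  field
    seq-∼ : seq x ∼ seq y

open _≈ℝ_ public

ℚ→ℝ : ℚ → ℝ
ℚ→ℝ q = mkℝ (λ _ → q) (const-∼ q)

_+ℝ_ _*ℝ_ : ℝ → ℝ → ℝ
x +ℝ y = mkℝ (λ n → seq x n ℚ.+ seq y n)
  (+-∼ {seq x} {seq x} {seq y} {seq y} (cauchy x) (cauchy y))
x *ℝ y = mkℝ (λ n → seq x n ℚ.* seq y n)
  (*-∼ {seq x} {seq x} {seq y} {seq y} (cauchy x) (cauchy y))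

-ℝ_ : ℝ → ℝ
-ℝ x = mkℝ (λ n → ℚ.- seq x n) (neg-∼ {seq x} {seq x} (cauchy x))

private
  pointwise-≈ : ∀ {x} y → (∀ n → seq x n ≡ seq y n) → x ≈ℝ y
  pointwise-≈ {x} y x≗y = mk≈ (pointwise {seq x} {seq y} (cauchy y) x≗y)

ℝ-isCommutativeRing :
  IsCommutativeRing _≈ℝ_ _+ℝ_ _*ℝ_ -ℝ_ (ℚ→ℝ 0ℚ) (ℚ→ℝ 1ℚ)
ℝ-isCommutativeRing = record
  { isRing = record
    { +-isAbelianGroup = record
      { isGroup = record
        { isMonoid = record
          { isSemigroup = record
            { isMagma = record
              { isEquivalence = record
                { refl  = λ {x} → mk≈ (cauchy x)
                ; sym   = λ {x} {y} x≈y →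
                    mk≈ (∼-sym {seq x} {seq y} (seq-∼ x≈y))
                ; trans = λ {x} {y} {z} x≈y y≈z →
                    mk≈ (∼-trans {seq x} {seq y} {seq z} (seq-∼ x≈y) (seq-∼ y≈z))
                }
              ; ∙-cong = λ {x} {x′} {y} {y′} x≈x′ y≈y′ → mk≈
                  (+-∼ {seq x} {seq x′} {seq y} {seq y′} (seq-∼ x≈x′) (seq-∼ y≈y′))
              }
            ; assoc = λ x y z → pointwise-≈ (x +ℝ (y +ℝ z))
                λ n → ℚₚ.+-assoc (seq x n) (seq y n) (seq z n)
            }
          ; identity =
              (λ x → pointwise-≈ x λ n → ℚₚ.+-identityˡ (seq x n))
            , (λ x → pointwise-≈ x λ n → ℚₚ.+-identityʳ (seq x n))
          }
        ; inverse =
            (λ x → pointwise-≈ (ℚ→ℝ 0ℚ) λ n → ℚₚ.+-inverseˡ (seq x n))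
          , (λ x → pointwise-≈ (ℚ→ℝ 0ℚ) λ n → ℚₚ.+-inverseʳ (seq x n))
        ; ⁻¹-cong = λ {x} {y} x≈y → mk≈ (neg-∼ {seq x} {seq y} (seq-∼ x≈y))
        }
      ; comm = λ x y → pointwise-≈ (y +ℝ x)
          λ n → ℚₚ.+-comm (seq x n) (seq y n)
      }
    ; *-cong = λ {x} {x′} {y} {y′} x≈x′ y≈y′ → mk≈
      (*-∼ {seq x} {seq x′} {seq y} {seq y′} (seq-∼ x≈x′) (seq-∼ y≈y′))
    ; *-assoc = λ x y z → pointwise-≈ (x *ℝ (y *ℝ z))
        λ n → ℚₚ.*-assoc (seq x n) (seq y n) (seq z n)
    ; *-identity =
        (λ x → pointwise-≈ x λ n → ℚₚ.*-identityˡ (seq x n))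
      , (λ x → pointwise-≈ x λ n → ℚₚ.*-identityʳ (seq x n))
    ; distrib =
        (λ x y z → pointwise-≈ ((x *ℝ y) +ℝ (x *ℝ z))
           λ n → ℚₚ.*-distribˡ-+ (seq x n) (seq y n) (seq z n))
      , (λ x y z → pointwise-≈ ((y *ℝ x) +ℝ (z *ℝ x))
           λ n → ℚₚ.*-distribʳ-+ (seq x n) (seq y n) (seq z n))
    }
  ; *-comm = λ x y → pointwise-≈ (y *ℝ x)
      λ n → ℚₚ.*-comm (seq x n) (seq y n)
  }

ℝ-commutativeRing : CommutativeRing 0ℓ 0ℓ
ℝ-commutativeRing = record { isCommutativeRing = ℝ-isCommutativeRing }

------------------------------------------------------------------------
-- Adjoining a square root i of -1: the pair (a , b) is a + b i

module AdjoinI {c ℓ} (R : CommutativeRing c ℓ) where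

  open CommutativeRing R

  private
    open SemiringSolver commutativeSemiring using (solve; _:=_; _:+_; _:*_)

    -- Writing -y as u y with u = -1 turns each identity into one that holds
    -- in commutative semirings, which needs no cancellation of coefficients.
    minus : ∀ {x y} → x - y ≈ x + - 1# * y
    minus = +-congˡ (sym (RingProperties.-1*x≈-x ring _))

    assoc-re : ∀ a b a′ b′ a″ b″ →
      (a * a′ - b * b′) * a″ - (a * b′ + b * a′) * b″
        ≈ a * (a′ * a″ - b′ * b″) - b * (a′ * b″ + b′ * a″)
    assoc-re a b a′ b′ a″ b″ = trans
      (trans minus (+-congʳ (*-congʳ minus)))
      (trans
        (solve 7 (λ u a b a′ b′ a″ b″ →
          (a :* a′ :+ u :* (b :* b′)) :* a″ :+ u :* ((a :* b′ :+ b :* a′) :* b″)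
            := a :* (a′ :* a″ :+ u :* (b′ :* b″)) :+ u :* (b :* (a′ :* b″ :+ b′ :* a″)))
          refl (- 1#) a b a′ b′ a″ b″)
        (sym (trans minus (+-congʳ (*-congˡ minus)))))

    assoc-im : ∀ a b a′ b′ a″ b″ →
      (a * a′ - b * b′) * b″ + (a * b′ + b * a′) * a″
        ≈ a * (a′ * b″ + b′ * a″) + b * (a′ * a″ - b′ * b″)
    assoc-im a b a′ b′ a″ b″ = trans
      (+-congʳ (*-congʳ minus))
      (trans
        (solve 7 (λ u a b a′ b′ a″ b″ →
          (a :* a′ :+ u :* (b :* b′)) :* b″ :+ (a :* b′ :+ b :* a′) :* a″
            := a :* (a′ :* b″ :+ b′ :* a″) :+ b :* (a′ :* a″ :+ u :* (b′ :* b″)))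
          refl (- 1#) a b a′ b′ a″ b″)
        (sym (+-congˡ (*-congˡ minus))))

    distribˡ-re : ∀ a b a′ b′ a″ b″ →
      a * (a′ + a″) - b * (b′ + b″) ≈ (a * a′ - b * b′) + (a * a″ - b * b″)
    distribˡ-re a b a′ b′ a″ b″ = trans minus (trans
      (solve 7 (λ u a b a′ b′ a″ b″ →
        a :* (a′ :+ a″) :+ u :* (b :* (b′ :+ b″))
          := (a :* a′ :+ u :* (b :* b′)) :+ (a :* a″ :+ u :* (b :* b″)))
        refl (- 1#) a b a′ b′ a″ b″)
      (sym (+-cong minus minus)))

    distribˡ-im : ∀ a b a′ b′ a″ b″ →
      a * (b′ + b″) + b * (a′ + a″) ≈ (a * b′ + b * a′) + (a * b″ + b * a″)
    distribˡ-im = solve 6 (λ a b a′ b′ a″ b″ →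
      a :* (b′ :+ b″) :+ b :* (a′ :+ a″)
        := (a :* b′ :+ b :* a′) :+ (a :* b″ :+ b :* a″)) refl

    distribʳ-re : ∀ a b a′ b′ a″ b″ →
      (a′ + a″) * a - (b′ + b″) * b ≈ (a′ * a - b′ * b) + (a″ * a - b″ * b)
    distribʳ-re a b a′ b′ a″ b″ = trans minus (trans
      (solve 7 (λ u a b a′ b′ a″ b″ →
        (a′ :+ a″) :* a :+ u :* ((b′ :+ b″) :* b)
          := (a′ :* a :+ u :* (b′ :* b)) :+ (a″ :* a :+ u :* (b″ :* b)))
        refl (- 1#) a b a′ b′ a″ b″)
      (sym (+-cong minus minus)))

    distribʳ-im : ∀ a b a′ b′ a″ b″ →
      (a′ + a″) * b + (b′ + b″) * a ≈ (a′ * b + b′ * a) + (a″ * b + b″ * a)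
    distribʳ-im = solve 6 (λ a b a′ b′ a″ b″ →
      (a′ :+ a″) :* b :+ (b′ :+ b″) :* a
        := (a′ :* b :+ b′ :* a) :+ (a″ :* b :+ b″ :* a)) refl

    minus-zero : ∀ {x y z} → x ≈ z → y ≈ 0# → x - y ≈ z
    minus-zero x≈z y≈0 = trans
      (+-cong x≈z (trans (-‿cong y≈0) (GroupProperties.ε⁻¹≈ε +-group)))
      (+-identityʳ _)

    plus-zero : ∀ {x y z} → x ≈ z → y ≈ 0# → x + y ≈ z
    plus-zero x≈z y≈0 = trans (+-cong x≈z y≈0) (+-identityʳ _)

    comm-re : ∀ a b a′ b′ → a * a′ - b * b′ ≈ a′ * a - b′ * b
    comm-re a b a′ b′ = +-cong (*-comm a a′) (-‿cong (*-comm b b′))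

    comm-im : ∀ a b a′ b′ → a * b′ + b * a′ ≈ a′ * b + b′ * a
    comm-im a b a′ b′ =
      trans (+-cong (*-comm a b′) (*-comm b a′)) (+-comm (b′ * a) (a′ * b))

  commutativeRing : CommutativeRing c ℓ
  commutativeRing = record
    { Carrier = Carrier × Carrier
    ; _≈_ = λ (a , b) (a′ , b′) → a ≈ a′ × b ≈ b′
    ; _+_ = λ (a , b) (a′ , b′) → a + a′ , b + b′
    ; _*_ = λ (a , b) (a′ , b′) → a * a′ - b * b′ , a * b′ + b * a′
    ; -_  = λ (a , b) → - a , - b
    ; 0#  = 0# , 0#
    ; 1#  = 1# , 0#
    ; isCommutativeRing = record
      { isRing = record
        { +-isAbelianGroup = record
          { isGroup = record
            { isMonoid = record
              { isSemigroup = record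
                { isMagma = record
                  { isEquivalence = record
                    { refl  = refl , refl
                    ; sym   = λ (p , q) →
                        sym p , sym q
                    ; trans = λ (p , q) (p′ , q′) →
                        trans p p′ , trans q q′
                    }
                  ; ∙-cong = λ (p , q) (p′ , q′) → +-cong p p′ , +-cong q q′
                  }
                ; assoc = λ (a , b) (a′ , b′) (a″ , b″) →
                    +-assoc a a′ a″ , +-assoc b b′ b″
                }
              ; identity =
                  (λ (a , b) → +-identityˡ a , +-identityˡ b)
                , (λ (a , b) → +-identityʳ a , +-identityʳ b)
              }
            ; inverse =
                (λ (a , b) → -‿inverseˡ a , -‿inverseˡ b)
              , (λ (a , b) → -‿inverseʳ a , -‿inverseʳ b)
            ; ⁻¹-cong = λ (p , q) → -‿cong p , -‿cong q
            }
          ; comm = λ (a , b) (a′ , b′) → +-comm a a′ , +-comm b b′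
          }
        ; *-cong = λ (p , q) (p′ , q′) →
            +-cong (*-cong p p′) (-‿cong (*-cong q q′))
          , +-cong (*-cong p q′) (*-cong q p′)
        ; *-assoc = λ (a , b) (a′ , b′) (a″ , b″) →
            assoc-re a b a′ b′ a″ b″ , assoc-im a b a′ b′ a″ b″
        ; *-identity =
            (λ (a , b) → minus-zero (*-identityˡ a) (zeroˡ b)
                       , plus-zero (*-identityˡ b) (zeroˡ a))
          , (λ (a , b) → minus-zero (*-identityʳ a) (zeroʳ b)
                       , trans (+-comm _ _) (plus-zero (*-identityʳ b) (zeroʳ a)))
        ; distrib =
            (λ (a , b) (a′ , b′) (a″ , b″) →
              distribˡ-re a b a′ b′ a″ b″ , distribˡ-im a b a′ b′ a″ b″)
          , (λ (a , b) (a′ , b′) (a″ , b″) →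
              distribʳ-re a b a′ b′ a″ b″ , distribʳ-im a b a′ b′ a″ b″)
        }
      ; *-comm = λ (a , b) (a′ , b′) → comm-re a b a′ b′ , comm-im a b a′ b′
      }
    }

ℂ-commutativeRing : CommutativeRing 0ℓ 0ℓ
ℂ-commutativeRing = AdjoinI.commutativeRing ℝ-commutativeRing

ℂ : Set
ℂ = CommutativeRing.Carrier ℂ-commutativeRing

ℚ→ℂ : ℚ → ℂ
ℚ→ℂ q = ℚ→ℝ q , ℚ→ℝ 0ℚ

ℕ→ℂ : ℕ → ℂ
ℕ→ℂ k = ℚ→ℂ (+ k ℚ./ 1)

------------------------------------------------------------------------
-- Polynomials, power series, Laurent series, rational functions

module Series {c ℓ} (R : CommutativeRing c ℓ) where

  open CommutativeRing R hiding (zero)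

  private
    module ≈-Reasoning = SetoidReasoning setoid

  -- The constant coefficient comes first; trailing zeros are allowed.
  Polynomial : Set c
  Polynomial = List Carrier

  coeff : Polynomial → ℕ → Carrier
  coeff []      _       = 0#
  coeff (a ∷ p) zero    = a
  coeff (a ∷ p) (suc n) = coeff p n

  infixl 6 _+ᴾ_
  infixl 7 _*ᴾ_
  infixr 8 _^ᴾ_

  _+ᴾ_ : Polynomial → Polynomial → Polynomial
  []      +ᴾ q       = q
  (a ∷ p) +ᴾ []      = a ∷ p
  (a ∷ p) +ᴾ (b ∷ q) = a + b ∷ p +ᴾ q

  _*ᴾ_ : Polynomial → Polynomial → Polynomial
  []      *ᴾ q = []
  (a ∷ p) *ᴾ q = List.map (a *_) q +ᴾ (0# ∷ p *ᴾ q)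

  _^ᴾ_ : Polynomial → ℕ → Polynomial
  p ^ᴾ zero  = [ 1# ]
  p ^ᴾ suc n = p *ᴾ p ^ᴾ n

  1-x : Polynomial
  1-x = 1# ∷ - 1# ∷ []

  Unit : Carrier → Set (c ⊔ ℓ)
  Unit = Invertible _≈_ 1# _*_

  PowerSeries : Set c
  PowerSeries = ℕ → Carrier

  -- Cauchy product, splitting off the constant term of the second factor.
  _⊛_ : PowerSeries → PowerSeries → PowerSeries
  (g ⊛ e) zero    = g 0 * e 0
  (g ⊛ e) (suc n) = e 0 * g (suc n) + (g ⊛ (λ k → e (suc k))) n

  ⊛-congˡ : ∀ g {e e′} → (∀ n → e n ≈ e′ n) → ∀ n → (g ⊛ e) n ≈ (g ⊛ e′) n
  ⊛-congˡ g e≈e′ zero    = *-congˡ (e≈e′ 0)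
  ⊛-congˡ g e≈e′ (suc n) =
    +-cong (*-congʳ (e≈e′ 0)) (⊛-congˡ g (λ k → e≈e′ (suc k)) n)

  -- Long division: with a = f 0 / g 0, the quotient f / g is
  -- a + x ((f - a g) / x) / g.
  quotient : PowerSeries → (g : PowerSeries) → Unit (g 0) → PowerSeries
  quotient f g u zero    = proj₁ u * f 0
  quotient f g u (suc n) =
    quotient (λ k → f (suc k) - (proj₁ u * f 0) * g (suc k)) g u n

  -- quotient f g u is the unique power series e with g ⊛ e = f.

  ⊛-quotient : ∀ f g u n → (g ⊛ quotient f g u) n ≈ f n
  ⊛-quotient f g (v , v*g₀≈1 , g₀*v≈1) zero = begin
    g 0 * (v * f 0)  ≈⟨ *-assoc (g 0) v (f 0) ⟨
    g 0 * v * f 0    ≈⟨ *-congʳ g₀*v≈1 ⟩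
    1# * f 0         ≈⟨ *-identityˡ (f 0) ⟩
    f 0              ∎
    where open ≈-Reasoning
  ⊛-quotient f g u (suc n) = begin
    a * g (suc n) + (g ⊛ quotient _ g u) n           ≈⟨ +-congˡ (⊛-quotient _ g u n) ⟩
    a * g (suc n) + (f (suc n) - a * g (suc n))      ≈⟨ cancel (a * g (suc n)) (f (suc n)) ⟩
    f (suc n)                                        ∎
    where
    open ≈-Reasoning
    a = proj₁ u * f 0
    cancel : ∀ x y → x + (y - x) ≈ y
    cancel x y = trans (+-comm x (y - x)) (trans (+-assoc y (- x) x)
      (trans (+-congˡ (-‿inverseˡ x)) (+-identityʳ y)))

  quotient-cong : ∀ {f f′} → (∀ n → f n ≈ f′ n) → ∀ g u n →
                  quotient f g u n ≈ quotient f′ g u n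
  quotient-cong f≈f′ g u zero    = *-congˡ (f≈f′ 0)
  quotient-cong f≈f′ g u (suc n) = quotient-cong
    (λ k → +-cong (f≈f′ (suc k)) (-‿cong (*-congʳ (*-congˡ (f≈f′ 0))))) g u n

  quotient-⊛ : ∀ g e u n → quotient (g ⊛ e) g u n ≈ e n
  quotient-⊛ g e (v , v*g₀≈1 , _) zero = begin
    v * (g 0 * e 0)  ≈⟨ *-assoc v (g 0) (e 0) ⟨
    v * g 0 * e 0    ≈⟨ *-congʳ v*g₀≈1 ⟩
    1# * e 0         ≈⟨ *-identityˡ (e 0) ⟩
    e 0              ∎
    where open ≈-Reasoning
  quotient-⊛ g e u (suc n) = begin
    quotient (λ k → (e 0 * g (suc k) + (g ⊛ e′) k) - a * g (suc k)) g u n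
      ≈⟨ quotient-cong (λ k → trans (+-congˡ (-‿cong (*-congʳ (quotient-⊛ g e u 0))))
           (cancel (e 0 * g (suc k)) ((g ⊛ e′) k))) g u n ⟩
    quotient (g ⊛ e′) g u n
      ≈⟨ quotient-⊛ g e′ u n ⟩
    e (suc n)
      ∎
    where
    open ≈-Reasoning
    e′ = λ k → e (suc k)
    a = proj₁ u * (g ⊛ e) 0
    cancel : ∀ x y → (x + y) - x ≈ y
    cancel x y = trans (+-congʳ (+-comm x y)) (trans (+-assoc y x (- x))
      (trans (+-congˡ (-‿inverseʳ x)) (+-identityʳ y)))

  record LaurentSeries : Set (c ⊔ ℓ) where
    field
      coefficient : ℤ → Carrier
      order       : ℤ
      vanishes    : ∀ k → k ℤ.< order → coefficient k ≈ 0#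

  open LaurentSeries public

  infix 4 _≋_

  _≋_ : LaurentSeries → LaurentSeries → Set ℓ
  F ≋ G = ∀ k → coefficient F k ≈ coefficient G k

  at : PowerSeries → ℤ → Carrier
  at f (+ n)    = f n
  at f -[1+ _ ] = 0#

  at-negative : ∀ f k → k ℤ.< + 0 → at f k ≈ 0#
  at-negative f -[1+ _ ] _ = refl
  at-negative f (+ _) (ℤ.+<+ ())

  -- The Laurent series of x⁻ᵏ f(x).
  x^-_·_ : ℕ → PowerSeries → LaurentSeries
  x^- k · f = record
    { coefficient = λ i → at f (i ℤ.+ + k)
    ; order       = ℤ.- + k
    ; vanishes    = λ i i<-k → at-negative f (i ℤ.+ + k)
        (subst (i ℤ.+ + k ℤ.<_) (ℤₚ.+-inverseˡ (+ k))
          (ℤₚ.+-monoˡ-< (+ k) i<-k))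
    }

  -- The rational function num / (xᵖ den), where p = pole.  Over a field,
  -- every nonzero polynomial is xᵖ den for some p and some den with
  -- den(0) ≠ 0, so these are all the rational functions.
  record RationalFunction : Set (c ⊔ ℓ) where
    field
      num      : Polynomial
      pole     : ℕ
      den      : Polynomial
      den-unit : Unit (coeff den 0)

  -- The Laurent expansion at x = 0.
  expansion : RationalFunction → LaurentSeries
  expansion r = x^- pole · quotient (coeff num) (coeff den) den-unit
    where open RationalFunction r

  -- The expansion at 0 identifies rational functions with certain Laurent
  -- series, and the formula defining Φ_b makes sense for all of them.
  Φ : (b : ℕ) .{{_ : NonZero b}} → LaurentSeries → LaurentSeries
  Φ b F = record
    { coefficient = λ n → coefficient F (+ b ℤ.* n ℤ.+ + (b ℕ.∸ 1))
    ; order       = order F ℤ.⊓ + 0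
    ; vanishes    = λ n n<o → vanishes F _ (bound b n n<o)
    }
    where
    rearrange : ∀ b n → b ℤ.* (+ 1 ℤ.+ n) ℤ.+ n ≡ (+ 1 ℤ.+ b) ℤ.* n ℤ.+ b
    rearrange = ℤ-solve-∀

    bound : ∀ b .{{_ : NonZero b}} n → n ℤ.< order F ℤ.⊓ + 0 →
            + b ℤ.* n ℤ.+ + (b ℕ.∸ 1) ℤ.< order F
    bound (suc b) n n<o = begin-strict
      + suc b ℤ.* n ℤ.+ + b        ≡⟨ rearrange (+ b) n ⟨
      + b ℤ.* ℤ.suc n ℤ.+ n        ≤⟨ ℤₚ.+-monoˡ-≤ n (ℤₚ.*-monoˡ-≤-nonNeg (+ b)
                                        (ℤₚ.i<j⇒suc[i]≤j (ℤₚ.<-≤-trans n<o (ℤₚ.i⊓j≤j (order F) (+ 0))))) ⟩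
      + b ℤ.* + 0 ℤ.+ n            ≡⟨ cong (ℤ._+ n) (ℤₚ.*-zeroʳ (+ b)) ⟩
      + 0 ℤ.+ n                    ≡⟨ ℤₚ.+-identityˡ n ⟩
      n                            <⟨ n<o ⟩
      order F ℤ.⊓ + 0              ≤⟨ ℤₚ.i⊓j≤i (order F) (+ 0) ⟩
      order F                      ∎
      where open ℤₚ.≤-Reasoning

  private
    coeff₀-+ : ∀ p q → coeff (p +ᴾ q) 0 ≈ coeff p 0 + coeff q 0
    coeff₀-+ []      q       = sym (+-identityˡ _)
    coeff₀-+ (a ∷ p) []      = sym (+-identityʳ a)
    coeff₀-+ (a ∷ p) (b ∷ q) = refl

    coeff₀-map : ∀ a q → coeff (List.map (a *_) q) 0 ≈ a * coeff q 0
    coeff₀-map a []      = sym (zeroʳ a)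
    coeff₀-map a (b ∷ q) = refl

    coeff₀-* : ∀ p q → coeff (p *ᴾ q) 0 ≈ coeff p 0 * coeff q 0
    coeff₀-* []      q = sym (zeroˡ _)
    coeff₀-* (a ∷ p) q = begin
      coeff (List.map (a *_) q +ᴾ (0# ∷ p *ᴾ q)) 0
        ≈⟨ coeff₀-+ (List.map (a *_) q) (0# ∷ p *ᴾ q) ⟩
      coeff (List.map (a *_) q) 0 + 0#
        ≈⟨ +-identityʳ _ ⟩
      coeff (List.map (a *_) q) 0
        ≈⟨ coeff₀-map a q ⟩
      a * coeff q 0
        ∎
      where open ≈-Reasoning

    coeff₀-1-x^ : ∀ n → coeff (1-x ^ᴾ n) 0 ≈ 1#
    coeff₀-1-x^ zero    = refl
    coeff₀-1-x^ (suc n) = trans (coeff₀-* 1-x (1-x ^ᴾ n))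
      (trans (*-identityˡ _) (coeff₀-1-x^ n))

  1-x^-unit : ∀ n → Unit (coeff (1-x ^ᴾ n) 0)
  1-x^-unit n = 1# , trans (*-identityˡ _) (coeff₀-1-x^ n)
                   , trans (*-identityʳ _) (coeff₀-1-x^ n)

  _/[1-x]^_ : Polynomial → ℕ → RationalFunction
  p /[1-x]^ n = record
    { num = p ; pole = 0 ; den = 1-x ^ᴾ n ; den-unit = 1-x^-unit n }

  -- The Laurent series f / (1-x)ⁿ for a power series f.
  _/ˢ[1-x]^_ : PowerSeries → ℕ → LaurentSeries
  f /ˢ[1-x]^ n = x^- 0 · quotient f (coeff (1-x ^ᴾ n)) (1-x^-unit n)

  -- Φ_b of a series p / (1-x)ⁿ has a unique numerator over (1-x)ⁿ.

  numerator : ∀ b .{{_ : NonZero b}} p n → ∃ λ f →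
              Φ b (expansion (p /[1-x]^ n)) ≋ f /ˢ[1-x]^ n
  numerator b p n = q ⊛ (λ k → coefficient F (+ k)) , eq
    where
    F = Φ b (expansion (p /[1-x]^ n))
    q = coeff (1-x ^ᴾ n)
    eq : F ≋ (q ⊛ (λ k → coefficient F (+ k))) /ˢ[1-x]^ n
    eq (+ k) rewrite ℕₚ.+-identityʳ k =
      sym (quotient-⊛ q (λ k → coefficient F (+ k)) (1-x^-unit n) k)
    eq -[1+ k ] = vanishes F -[1+ k ] ℤ.-<+

  numerator-unique : ∀ f f′ n → f /ˢ[1-x]^ n ≋ f′ /ˢ[1-x]^ n →
                     ∀ i → f i ≈ f′ i
  numerator-unique f f′ n f≋f′ i = begin
    f i                      ≈⟨ ⊛-quotient f q u i ⟨
    (q ⊛ quotient f q u) i   ≈⟨ ⊛-congˡ q same i ⟩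
    (q ⊛ quotient f′ q u) i  ≈⟨ ⊛-quotient f′ q u i ⟩
    f′ i                     ∎
    where
    open ≈-Reasoning
    q = coeff (1-x ^ᴾ n)
    u = 1-x^-unit n
    same : ∀ k → quotient f q u k ≈ quotient f′ q u k
    same k with f≋f′ (+ k)
    ... | e rewrite ℕₚ.+-identityʳ k = e

------------------------------------------------------------------------
-- The carries chain

digits : (b m : ℕ) → List (Vec (Fin b) m)
digits b zero    = [ Vec.[] ]
digits b (suc m) = cartesianProductWith Vec._∷_ (allFin b) (digits b m)

nextCarry : (b : ℕ) .{{_ : NonZero b}} → ∀ {m} → ℕ → Vec (Fin b) m → ℕ
nextCarry b c ys = (c ℕ.+ Vec.sum (Vec.map toℕ ys)) ℕ./ b

-- The probability of passing from carry c to carry d when m numbers are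
-- added in base b.
K : (b : ℕ) .{{_ : NonZero b}} → (m : ℕ) → ℕ → ℕ → ℚ
K b m c d =
  (+ length (filter (λ ys → nextCarry b c ys ℕₚ.≟ d) (digits b m)) ℚ./ (b ℕ.^ m))
    {{ℕₚ.m^n≢0 b m}}

open CommutativeRing ℂ-commutativeRing public
  using () renaming (_≈_ to _≈ℂ_; _*_ to _*ℂ_)
open import Algebra.Properties.CommutativeMonoid.Sum
  (CommutativeRing.+-commutativeMonoid ℂ-commutativeRing) public
  using (sum-syntax)
open Series ℂ-commutativeRing public
  using (_≋_; Φ; expansion; _/[1-x]^_; _/ˢ[1-x]^_)

{-# OPTIONS --safe #-}

-- Write X for multiplication by x, Δ = 1 - X and box = 1 + X + ... + X^(b-1), acting
-- on power series, and U for the extraction of the coefficients of index b k + (b - 1).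
-- Then U X^b = X U and Δ box = 1 - X^b give Δ U = U box Δ, hence Δⁿ U = U boxⁿ Δⁿ.
-- Applied to h / (1-x)ⁿ this yields h' = U boxⁿ h, so that h'_i is the sum of the h_j
-- over all digits y_1, ..., y_n with j + y_1 + ... + y_n = b i + (b - 1).  The digits
-- y_2, ..., y_n are subject only to ⌊(j + y_2 + ... + y_n) / b⌋ = i, and y_1 is then
-- determined.
module Submission where

open import Defs hiding (_≋_; Φ; expansion; _/[1-x]^_; _/ˢ[1-x]^_; sum-syntax)
open import Algebra.Bundles using (CommutativeRing; Semiring)
open import Algebra.Morphism.Structures using (IsSemiringHomomorphism)
import Algebra.Properties.AbelianGroup as AbelianGroupProperties
import Algebra.Properties.CommutativeMonoid.Sum as CommutativeMonoidSum
import Algebra.Properties.CommutativeSemigroup as CommutativeSemigroupProperties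
import Algebra.Properties.Monoid.Mult as MonoidMult
import Algebra.Properties.Ring as RingProperties
import Algebra.Properties.Semiring.Sum as SemiringSum
open import Data.Bool.Base using (Bool; true; false; if_then_else_)
open import Data.Fin.Base as Fin using (Fin; zero; suc; toℕ; opposite)
import Data.Fin.Properties as Finₚ
open import Data.Integer.Base as ℤ using (+_)
import Data.Integer.Properties as ℤₚ
open import Data.Integer.Tactic.RingSolver using () renaming (solve-∀ to ℤ-solve-∀)
open import Data.List.Base as List using (List; []; _∷_; length; filter; _++_; cartesianProductWith)
open import Data.Nat.Base as ℕ using (ℕ; zero; suc; NonZero; _≤_; _∸_; _^_; s≤s)
open import Data.Nat.Divisibility using (n∣m*n)
open import Data.Nat.DivMod using (_/_; _%_; _mod_; m≡m%n+[m/n]*n; m<n⇒m/n≡0; m*n/n≡m; +-distrib-/-∣ʳ; m%n<n)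
open import Data.Nat.GeneralisedArithmetic using (fold; fold-+)
import Data.Nat.Properties as ℕₚ
open import Data.Product.Base using (_,_)
open import Data.Rational.Base as ℚ using (ℚ; 0ℚ; 1ℚ)
import Data.Rational.Properties as ℚₚ
open import Data.Rational.Unnormalised.Base as ℚᵘ using (mkℚᵘ; *≡*)
import Data.Rational.Unnormalised.Properties as ℚᵘₚ
open import Data.Vec.Base as Vec using (Vec; _∷_)
open import Data.Vec.Functional using (Vector; toList)
open import Function.Base using (_∘_)
open import Relation.Binary.PropositionalEquality.Core as ≡ using (_≡_; _≢_; cong; cong₂)
open import Relation.Binary.PropositionalEquality.Properties using (module ≡-Reasoning)
import Relation.Binary.Reasoning.Setoid as SetoidReasoning
open import Relation.Nullary.Decidable.Core using (Dec; does; yes; no)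
open import Relation.Nullary.Decidable using (dec-true; dec-false)
open import Relation.Nullary.Negation using (¬_)
open import Relation.Unary using (Decidable)

-- Division with remainder and the completing digit

digitSum : ∀ {b m} → Vec (Fin b) m → ℕ
digitSum ys = Vec.sum (Vec.map toℕ ys)

-- Equal to `b ^ m` times `K b m j i`; a count in `ℕ` keeps the combinatorics free of fractions,
-- over any commutative ring.
carryCount : (b : ℕ) .{{_ : NonZero b}} (m j i : ℕ) → ℕ
carryCount b m j i = length (filter (λ ys → nextCarry b j ys ℕₚ.≟ i) (digits b m))

-- Cancelling `y` leaves `t = (b - 1 - y) + i b`, where `b - 1 - y` is below `b` and hence does not
-- affect the quotient.
completing-digit⇒carry : ∀ b .{{_ : NonZero b}} (y : Fin b) t i →
  toℕ y ℕ.+ t ≡ b ℕ.* i ℕ.+ (b ∸ 1) → t / b ≡ i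
completing-digit⇒carry (suc c) y t i eq = begin
  t / b                           ≡⟨ cong (_/ b) (ℕₚ.+-cancelˡ-≡ (toℕ y) _ _ y+t≡) ⟩
  (r ℕ.+ i ℕ.* b) / b             ≡⟨ +-distrib-/-∣ʳ r (n∣m*n i) ⟩
  r / b ℕ.+ i ℕ.* b / b           ≡⟨ cong₂ ℕ._+_ (m<n⇒m/n≡0 (s≤s (ℕₚ.m∸n≤m c (toℕ y)))) (m*n/n≡m i b) ⟩
  i                               ∎
  where
  open ≡-Reasoning
  b = suc c
  r = c ∸ toℕ y
  y+t≡ : toℕ y ℕ.+ t ≡ toℕ y ℕ.+ (r ℕ.+ i ℕ.* b)
  y+t≡ = begin
    toℕ y ℕ.+ t                   ≡⟨ eq ⟩
    b ℕ.* i ℕ.+ c                 ≡⟨ ℕₚ.+-comm (b ℕ.* i) c ⟩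
    c ℕ.+ b ℕ.* i                 ≡⟨ cong₂ ℕ._+_ (ℕₚ.m+[n∸m]≡n (ℕ.s≤s⁻¹ (Finₚ.toℕ<n y))) (ℕₚ.*-comm i b) ⟨
    toℕ y ℕ.+ r ℕ.+ i ℕ.* b       ≡⟨ ℕₚ.+-assoc (toℕ y) r (i ℕ.* b) ⟩
    toℕ y ℕ.+ (r ℕ.+ i ℕ.* b)     ∎

-- `opposite` sends a digit `r` to `b - 1 - r`, so adding the opposite of `t % b` raises the
-- remainder of `t` to `b - 1` and leaves its quotient alone.
carry⇒completing-digit : ∀ b .{{_ : NonZero b}} t →
  toℕ (opposite (t mod b)) ℕ.+ t ≡ b ℕ.* (t / b) ℕ.+ (b ∸ 1)
carry⇒completing-digit b@(suc c) t = begin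
  toℕ (opposite (t mod b)) ℕ.+ t            ≡⟨ cong (ℕ._+ t) (Finₚ.opposite-prop (t mod b)) ⟩
  c ∸ toℕ (t mod b) ℕ.+ t                   ≡⟨ cong (λ r → c ∸ r ℕ.+ t) (Finₚ.toℕ-fromℕ< (m%n<n t b)) ⟩
  c ∸ t % b ℕ.+ t                           ≡⟨ cong (c ∸ t % b ℕ.+_) (m≡m%n+[m/n]*n t b) ⟩
  c ∸ t % b ℕ.+ (t % b ℕ.+ t / b ℕ.* b)     ≡⟨ ℕₚ.+-assoc (c ∸ t % b) (t % b) _ ⟨
  c ∸ t % b ℕ.+ t % b ℕ.+ t / b ℕ.* b       ≡⟨ cong₂ ℕ._+_ (ℕₚ.m∸n+n≡m (ℕ.s≤s⁻¹ (m%n<n t b))) (ℕₚ.*-comm (t / b) b) ⟩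
  c ℕ.+ b ℕ.* (t / b)                       ≡⟨ ℕₚ.+-comm c _ ⟩
  b ℕ.* (t / b) ℕ.+ c                       ∎
  where open ≡-Reasoning

module PowerSeriesOperators {c ℓ} (R : CommutativeRing c ℓ) where

  open CommutativeRing R hiding (zero)
  open Series R
  open CommutativeMonoidSum +-commutativeMonoid
  open MonoidMult +-monoid using (_×_)
  open RingProperties ring using (-0#≈0#; -1*x≈-x; x[y-z]≈xy-xz)
  open AbelianGroupProperties +-abelianGroup using (⁻¹-∙-comm; \\-leftDividesʳ)
  open CommutativeSemigroupProperties +-commutativeSemigroup using (interchange)
  open SetoidReasoning setoid

  infix 4 _≐_

  _≐_ : PowerSeries → PowerSeries → Set ℓ
  f ≐ g = ∀ k → f k ≈ g k

  ≐-sym : ∀ {f g} → f ≐ g → g ≐ f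
  ≐-sym f≐g k = sym (f≐g k)

  ≐-trans : ∀ {f g e} → f ≐ g → g ≐ e → f ≐ e
  ≐-trans f≐g g≐e k = trans (f≐g k) (g≐e k)

  x-0≈x : ∀ x → x - 0# ≈ x
  x-0≈x x = trans (+-congˡ -0#≈0#) (+-identityʳ x)

  [w+x]-[y+z]≈[w-y]+[x-z] : ∀ w x y z → (w + x) - (y + z) ≈ (w - y) + (x - z)
  [w+x]-[y+z]≈[w-y]+[x-z] w x y z =
    trans (+-congˡ (sym (⁻¹-∙-comm y z))) (interchange w x (- y) (- z))

  [x-y]+[y-z]≈x-z : ∀ x y z → (x - y) + (y - z) ≈ x - z
  [x-y]+[y-z]≈x-z x y z = trans (+-assoc x (- y) (y - z)) (+-congˡ (\\-leftDividesʳ y (- z)))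

  -- Finite sums, sums over lists, indicators

  sum-zero : ∀ {n} {t : Vector Carrier n} → (∀ i → t i ≈ 0#) → sum t ≈ 0#
  sum-zero {n} t≈0 = trans (sum-cong-≋ t≈0) (sum-replicate-zero n)

  sum-single : ∀ {n} {t : Vector Carrier n} i → (∀ j → j ≢ i → t j ≈ 0#) → sum t ≈ t i
  sum-single {suc n} {t} i t≈0 = begin
    sum t                               ≈⟨ sum-remove {i = i} t ⟩
    t i + sum (t ∘ Fin.punchIn i)       ≈⟨ +-congˡ (sum-zero λ j → t≈0 _ (Finₚ.punchInᵢ≢i i j)) ⟩
    t i + 0#                            ≈⟨ +-identityʳ (t i) ⟩
    t i                                 ∎

  -- Indexed by positions, so that the lemmas on finite sums, exchange of summation above all, apply
  -- to lists as they stand.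
  listSum : ∀ {a} {A : Set a} → List A → (A → Carrier) → Carrier
  listSum xs f = ∑[ k < length xs ] f (List.lookup xs k)

  listSum-cong : ∀ {a} {A : Set a} (xs : List A) {f g} →
    (∀ x → f x ≈ g x) → listSum xs f ≈ listSum xs g
  listSum-cong xs f≈g = sum-cong-≋ {length xs} (f≈g ∘ List.lookup xs)

  ∑-listSum-comm : ∀ {n a} {A : Set a} (xs : List A) (F : Fin n → A → Carrier) →
    ∑[ i < n ] listSum xs (F i) ≈ listSum xs λ x → ∑[ i < n ] F i x
  ∑-listSum-comm {n} xs F = ∑-comm {n} {length xs} λ i k → F i (List.lookup xs k)

  listSum-++ : ∀ {a} {A : Set a} (xs ys : List A) f →
    listSum (xs ++ ys) f ≈ listSum xs f + listSum ys f
  listSum-++ []       ys f = sym (+-identityˡ _)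
  listSum-++ (x ∷ xs) ys f =
    trans (+-congˡ (listSum-++ xs ys f)) (sym (+-assoc _ _ _))

  listSum-map : ∀ {a b} {A : Set a} {B : Set b} (g : A → B) xs f →
    listSum (List.map g xs) f ≈ listSum xs (f ∘ g)
  listSum-map g []       f = refl
  listSum-map g (x ∷ xs) f = +-congˡ (listSum-map g xs f)

  listSum-cartesianProductWith : ∀ {a b c} {A : Set a} {B : Set b} {C : Set c}
    (g : A → B → C) xs ys f →
    listSum (cartesianProductWith g xs ys) f ≈ listSum xs λ x → listSum ys λ y → f (g x y)
  listSum-cartesianProductWith g []       ys f = refl
  listSum-cartesianProductWith g (x ∷ xs) ys f =
    trans (listSum-++ (List.map (g x) ys) (cartesianProductWith g xs ys) f)
      (+-cong (listSum-map (g x) ys f) (listSum-cartesianProductWith g xs ys f))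

  listSum-tabulate : ∀ {a} {A : Set a} {n} (g : Fin n → A) f →
    listSum (List.tabulate g) f ≈ ∑[ i < n ] f (g i)
  listSum-tabulate {n = zero}  g f = refl
  listSum-tabulate {n = suc n} g f = +-congˡ (listSum-tabulate (g ∘ suc) f)

  listSum-digits : ∀ b m f →
    listSum (digits b (suc m)) f ≈ ∑[ y < b ] listSum (digits b m) λ ys → f (y ∷ ys)
  listSum-digits b m f = trans
    (listSum-cartesianProductWith _∷_ (List.allFin b) (digits b m) f)
    (listSum-tabulate {n = b} (λ y → y) _)

  infix 8 [_]_

  -- Only the Boolean of a decision enters, so the test `suc m ≟ suc n` reduces to `m ≟ n`; the
  -- induction in `shift^-coeff-toList` relies on this.
  [_]_ : Bool → Carrier → Carrier
  [ d ] z = if d then z else 0#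

  indicator-true : ∀ {p} {P : Set p} (P? : Dec P) {z} → P → [ does P? ] z ≈ z
  indicator-true P? p = reflexive (cong ([_] _) (dec-true P? p))

  indicator-false : ∀ {p} {P : Set p} (P? : Dec P) {z} → ¬ P → [ does P? ] z ≈ 0#
  indicator-false P? ¬p = reflexive (cong ([_] _) (dec-false P? ¬p))

  listSum-filter : ∀ {a p} {A : Set a} {P : A → Set p} (P? : Decidable P) xs z →
    listSum xs (λ x → [ does (P? x) ] z) ≈ length (filter P? xs) × z
  listSum-filter P? []       z = refl
  listSum-filter P? (x ∷ xs) z with does (P? x)
  ... | true  = +-congˡ (listSum-filter P? xs z)
  ... | false = trans (+-identityˡ _) (listSum-filter P? xs z)

  -- The first digit is forced: exactly one `y` contributes if `t / b` is `i`, and none does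
  -- otherwise. Summing it out leaves the carry condition on the remaining digits.
  ∑-completing-digit : ∀ b .{{_ : NonZero b}} t i z →
    ∑[ y < b ] ([ does (toℕ y ℕ.+ t ℕₚ.≟ b ℕ.* i ℕ.+ (b ∸ 1)) ] z)
      ≈ [ does (t / b ℕₚ.≟ i) ] z
  ∑-completing-digit b t i z = by-cases (t / b ℕₚ.≟ i)
    where
    N = b ℕ.* i ℕ.+ (b ∸ 1)
    y = opposite (t mod b)
    by-cases : Dec (t / b ≡ i) →
      ∑[ y < b ] ([ does (toℕ y ℕ.+ t ℕₚ.≟ N) ] z) ≈ [ does (t / b ℕₚ.≟ i) ] z
    by-cases (no t/b≢i) = trans
      (sum-zero λ y → indicator-false (toℕ y ℕ.+ t ℕₚ.≟ N) (t/b≢i ∘ completing-digit⇒carry b y t i))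
      (sym (indicator-false (t / b ℕₚ.≟ i) t/b≢i))
    by-cases (yes t/b≡i) = begin
      ∑[ y < b ] ([ does (toℕ y ℕ.+ t ℕₚ.≟ N) ] z)
        ≈⟨ sum-single y (λ y′ y′≢y → indicator-false (toℕ y′ ℕ.+ t ℕₚ.≟ N) λ eq →
             y′≢y (Finₚ.toℕ-injective (ℕₚ.+-cancelʳ-≡ t _ _ (≡.trans eq (≡.sym y+t≡N))))) ⟩
      [ does (toℕ y ℕ.+ t ℕₚ.≟ N) ] z
        ≈⟨ indicator-true (toℕ y ℕ.+ t ℕₚ.≟ N) y+t≡N ⟩
      z
        ≈⟨ indicator-true (t / b ℕₚ.≟ i) t/b≡i ⟨
      [ does (t / b ℕₚ.≟ i) ] z
        ∎
      where
      y+t≡N : toℕ y ℕ.+ t ≡ N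
      y+t≡N = ≡.trans (carry⇒completing-digit b t) (cong (λ q → b ℕ.* q ℕ.+ (b ∸ 1)) t/b≡i)

  -- Shifts, differences, boxes and decimation

  shift : PowerSeries → PowerSeries
  shift f zero    = 0#
  shift f (suc k) = f k

  shift^ : ℕ → PowerSeries → PowerSeries
  shift^ t f = fold f shift t

  Δ : PowerSeries → PowerSeries
  Δ f k = f k - shift f k

  Δ^ : ℕ → PowerSeries → PowerSeries
  Δ^ n f = fold f Δ n

  box : ℕ → PowerSeries → PowerSeries
  box b f k = ∑[ y < b ] shift^ (toℕ y) f k

  box^ : ℕ → ℕ → PowerSeries → PowerSeries
  box^ b n f = fold f (box b) n

  -- This is `Φ b` on indices `k ≥ 0`. For `k < 0` the index `b k + (b - 1)` is negative too, so
  -- nothing is lost for an expansion without a pole.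
  decimate : ℕ → PowerSeries → PowerSeries
  decimate b f k = f (b ℕ.* k ℕ.+ (b ∸ 1))

  shift-cong : ∀ {f g} → f ≐ g → shift f ≐ shift g
  shift-cong f≐g zero    = refl
  shift-cong f≐g (suc k) = f≐g k

  shift^-cong : ∀ t {f g} → f ≐ g → shift^ t f ≐ shift^ t g
  shift^-cong zero    f≐g = f≐g
  shift^-cong (suc t) f≐g = shift-cong (shift^-cong t f≐g)

  shift-∑ : ∀ {n} (F : Fin n → PowerSeries) →
    shift (λ k → ∑[ i < n ] F i k) ≐ λ k → ∑[ i < n ] shift (F i) k
  shift-∑ {n} F zero    = sym (sum-replicate-zero n)
  shift-∑     F (suc k) = refl

  shift^-∑ : ∀ t {n} (F : Fin n → PowerSeries) →
    shift^ t (λ k → ∑[ i < n ] F i k) ≐ λ k → ∑[ i < n ] shift^ t (F i) k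
  shift^-∑ zero    F k = refl
  shift^-∑ (suc t) F   = ≐-trans (shift-cong (shift^-∑ t F)) (shift-∑ (λ i → shift^ t (F i)))

  Δ-cong : ∀ {f g} → f ≐ g → Δ f ≐ Δ g
  Δ-cong f≐g k = +-cong (f≐g k) (-‿cong (shift-cong f≐g k))

  Δ^-cong : ∀ n {f g} → f ≐ g → Δ^ n f ≐ Δ^ n g
  Δ^-cong zero    f≐g = f≐g
  Δ^-cong (suc n) f≐g = Δ-cong (Δ^-cong n f≐g)

  box-cong : ∀ b {f g} → f ≐ g → box b f ≐ box b g
  box-cong b f≐g k = sum-cong-≋ {b} λ y → shift^-cong (toℕ y) f≐g k

  box^-cong : ∀ b n {f g} → f ≐ g → box^ b n f ≐ box^ b n g
  box^-cong b zero    f≐g = f≐g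
  box^-cong b (suc n) f≐g = box-cong b (box^-cong b n f≐g)

  -- Horner form of `1 + x + ... + x^b`, the recursion behind the inductions on `b` that follow.
  box-suc : ∀ b f → box (suc b) f ≐ λ k → f k + shift (box b f) k
  box-suc b f k = +-congˡ (sym (shift-∑ (λ y → shift^ (toℕ {b} y) f) k))

  Δ-+-shift : ∀ f g → Δ (λ k → f k + shift g k) ≐ λ k → Δ f k + shift (Δ g) k
  Δ-+-shift f g zero    = trans
    (+-cong (+-identityʳ _) refl) (sym (+-identityʳ _))
  Δ-+-shift f g (suc k) = [w+x]-[y+z]≈[w-y]+[x-z] (f (suc k)) (g k) (f k) (shift g k)

  Δ-box-suc : ∀ b f → Δ (box (suc b) f) ≐ λ k → Δ f k + shift (Δ (box b f)) k
  Δ-box-suc b f = ≐-trans (Δ-cong (box-suc b f)) (Δ-+-shift f (box b f))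

  -- Both operators are multiplications by polynomials in `x`; the induction only uses that `Δ` is
  -- additive and commutes with `shift`.
  Δ-box : ∀ b f → Δ (box b f) ≐ box b (Δ f)
  Δ-box zero    f zero    = x-0≈x 0#
  Δ-box zero    f (suc k) = x-0≈x 0#
  Δ-box (suc b) f = ≐-trans (Δ-box-suc b f) (≐-trans
    (λ k → +-congˡ (shift-cong (Δ-box b f) k)) (≐-sym (box-suc b (Δ f))))

  Δ-box^ : ∀ b n f → Δ (box^ b n f) ≐ box^ b n (Δ f)
  Δ-box^ b zero    f k = refl
  Δ-box^ b (suc n) f = ≐-trans (Δ-box b (box^ b n f)) (box-cong b (Δ-box^ b n f))

  -- The geometric sum `(1 - x)(1 + ... + x^(b-1)) = 1 - x^b`: in Horner form, `f - x f` and
  -- `x (f - x^b f)` add up to `f - x^(b+1) f`.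
  Δ-box-telescopes : ∀ b f → Δ (box b f) ≐ λ k → f k - shift^ b f k
  Δ-box-telescopes zero    f zero    = trans (-‿inverseʳ 0#) (sym (-‿inverseʳ (f 0)))
  Δ-box-telescopes zero    f (suc k) = trans (-‿inverseʳ 0#) (sym (-‿inverseʳ (f (suc k))))
  Δ-box-telescopes (suc b) f zero    = trans (Δ-box-suc b f 0) (+-identityʳ _)
  Δ-box-telescopes (suc b) f (suc k) = begin
    Δ (box (suc b) f) (suc k)                      ≈⟨ Δ-box-suc b f (suc k) ⟩
    (f (suc k) - f k) + Δ (box b f) k              ≈⟨ +-congˡ (Δ-box-telescopes b f k) ⟩
    (f (suc k) - f k) + (f k - shift^ b f k)       ≈⟨ [x-y]+[y-z]≈x-z _ _ _ ⟩
    f (suc k) - shift^ b f k                       ∎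

  shift^-+ : ∀ t f k → shift^ t f (t ℕ.+ k) ≡ f k
  shift^-+ zero    f k = ≡.refl
  shift^-+ (suc t) f k = shift^-+ t f k

  shift^-< : ∀ {t k} f → k ℕ.< t → shift^ t f k ≡ 0#
  shift^-< {suc t} {zero}  f _         = ≡.refl
  shift^-< {suc t} {suc k} f (s≤s k<t) = shift^-< f k<t

  -- Lowering an index `b (k + 1) + (b - 1)` by `b` lowers the decimated index by one.
  decimate-shift^ : ∀ b .{{_ : NonZero b}} f → decimate b (shift^ b f) ≐ shift (decimate b f)
  -- Here the index is `b - 1`, the last one at which a series shifted by `b` is still zero.
  decimate-shift^ (suc c) f zero    = reflexive (shift^-< f (ℕₚ.≤-reflexive
    (cong (λ n → suc (n ℕ.+ c)) (ℕₚ.*-zeroʳ c))))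
  decimate-shift^ b@(suc c) f (suc k) = reflexive (≡.trans
    (cong (shift^ b f) (≡.trans (cong (ℕ._+ c) (ℕₚ.*-suc b k)) (ℕₚ.+-assoc b (b ℕ.* k) c)))
    (shift^-+ b f (b ℕ.* k ℕ.+ c)))

  -- Decimation turns `1 - x^b` into `1 - x`, and `1 - x^b` is `box b` times `Δ`.
  Δ-decimate : ∀ b .{{_ : NonZero b}} f → Δ (decimate b f) ≐ decimate b (box b (Δ f))
  Δ-decimate b f k = begin
    decimate b f k - shift (decimate b f) k        ≈⟨ +-congˡ (-‿cong (decimate-shift^ b f k)) ⟨
    decimate b f k - decimate b (shift^ b f) k     ≈⟨ Δ-box-telescopes b f _ ⟨
    decimate b (Δ (box b f)) k                     ≈⟨ Δ-box b f _ ⟩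
    decimate b (box b (Δ f)) k                     ∎

  -- Each `Δ` that passes the decimation leaves a `box` behind. If `f` has numerator `Δ^ n f` over
  -- `(1-x)^n`, this computes the numerator of its decimation.
  Δ^-decimate : ∀ b .{{_ : NonZero b}} n f →
    Δ^ n (decimate b f) ≐ decimate b (box^ b n (Δ^ n f))
  Δ^-decimate b zero    f k = refl
  Δ^-decimate b (suc n) f = ≐-trans (Δ-cong (Δ^-decimate b n f)) (≐-trans
    (Δ-decimate b (box^ b n (Δ^ n f)))
    -- The new `Δ` still stands outside the earlier boxes and is moved past them.
    (λ k → box-cong b (Δ-box^ b n (Δ^ n f)) _))

  -- Multiplication by powers of `1 - x` as iterated differences

  coeff-+ᴾ : ∀ p q k → coeff (p +ᴾ q) k ≈ coeff p k + coeff q k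
  coeff-+ᴾ []      q       k       = sym (+-identityˡ _)
  coeff-+ᴾ (a ∷ p) []      k       = sym (+-identityʳ _)
  coeff-+ᴾ (a ∷ p) (b ∷ q) zero    = refl
  coeff-+ᴾ (a ∷ p) (b ∷ q) (suc k) = coeff-+ᴾ p q k

  coeff-map-* : ∀ a p k → coeff (List.map (a *_) p) k ≈ a * coeff p k
  coeff-map-* a []      k       = sym (zeroʳ a)
  coeff-map-* a (b ∷ p) zero    = refl
  coeff-map-* a (b ∷ p) (suc k) = coeff-map-* a p k

  coeff-1-x* : ∀ p → coeff (1-x *ᴾ p) ≐ Δ (coeff p)
  coeff-1-x* p k = trans (coeff-+ᴾ (List.map (1# *_) p) _ k)
    (+-cong (trans (coeff-map-* 1# p k) (*-identityˡ _)) (second k))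
    where
    -- `*ᴾ` ends with `0# ∷ []` once the coefficients of `1-x` are used up.
    coeff-0 : ∀ k → coeff (0# ∷ []) k ≈ 0#
    coeff-0 zero    = refl
    coeff-0 (suc k) = refl
    second : ∀ k → coeff (0# ∷ List.map (- 1# *_) p +ᴾ (0# ∷ [])) k ≈ - shift (coeff p) k
    second zero    = sym -0#≈0#
    second (suc k) = begin
      coeff (List.map (- 1# *_) p +ᴾ (0# ∷ [])) k                ≈⟨ coeff-+ᴾ (List.map (- 1# *_) p) _ k ⟩
      coeff (List.map (- 1# *_) p) k + coeff (0# ∷ []) k         ≈⟨ +-cong (coeff-map-* (- 1#) p k) (coeff-0 k) ⟩
      - 1# * coeff p k + 0#                                      ≈⟨ +-identityʳ _ ⟩
      - 1# * coeff p k                                           ≈⟨ -1*x≈-x _ ⟩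
      - coeff p k                                                ∎

  ⊛-congʳ : ∀ {g g′} e → g ≐ g′ → g ⊛ e ≐ g′ ⊛ e
  ⊛-congʳ e g≐g′ zero    = *-congʳ (g≐g′ 0)
  ⊛-congʳ e g≐g′ (suc k) = +-cong (*-congˡ (g≐g′ (suc k))) (⊛-congʳ _ g≐g′ k)

  -- Multiplication by `e 0 + x e′` in one formula that also covers index 0; `Δ-⊛` needs it at an
  -- index `k` that is not split into cases.
  ⊛-unfold : ∀ g e → g ⊛ e ≐ λ k → e 0 * g k + shift (g ⊛ (e ∘ suc)) k
  ⊛-unfold g e zero    = trans (*-comm (g 0) (e 0)) (sym (+-identityʳ _))
  ⊛-unfold g e (suc k) = refl

  -- Associativity of the product with `1 - x`, by induction on the index along the recursion of `⊛`
  -- in its second factor.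
  Δ-⊛ : ∀ g e → Δ g ⊛ e ≐ Δ (g ⊛ e)
  Δ-⊛ g e zero    = trans (*-congʳ (x-0≈x (g 0))) (sym (x-0≈x _))
  Δ-⊛ g e (suc k) = begin
    e 0 * (g (suc k) - g k) + (Δ g ⊛ e′) k
      ≈⟨ +-cong (x[y-z]≈xy-xz _ _ _) (Δ-⊛ g e′ k) ⟩
    (e 0 * g (suc k) - e 0 * g k) + ((g ⊛ e′) k - shift (g ⊛ e′) k)
      ≈⟨ [w+x]-[y+z]≈[w-y]+[x-z] _ _ _ _ ⟨
    (g ⊛ e) (suc k) - (e 0 * g k + shift (g ⊛ e′) k)
      ≈⟨ +-congˡ (-‿cong (⊛-unfold g e k)) ⟨
    (g ⊛ e) (suc k) - (g ⊛ e) k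
      ∎
    where e′ = e ∘ suc

  1-⊛ : ∀ e → coeff (1# ∷ []) ⊛ e ≐ e
  1-⊛ e zero    = *-identityˡ (e 0)
  1-⊛ e (suc k) = trans (+-cong (zeroʳ (e 0)) (1-⊛ (e ∘ suc) k)) (+-identityˡ _)

  1-x^⊛≐Δ^ : ∀ n e → coeff (1-x ^ᴾ n) ⊛ e ≐ Δ^ n e
  1-x^⊛≐Δ^ zero    e = 1-⊛ e
  1-x^⊛≐Δ^ (suc n) e = ≐-trans (⊛-congʳ e (coeff-1-x* (1-x ^ᴾ n)))
    (≐-trans (Δ-⊛ (coeff (1-x ^ᴾ n)) e) (Δ-cong (1-x^⊛≐Δ^ n e)))

  -- Clears the denominator: `Δ^ n` is multiplication by `(1-x)^n`, which undoes the long division.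
  Δ^-quotient : ∀ n f → Δ^ n (quotient f (coeff (1-x ^ᴾ n)) (1-x^-unit n)) ≐ f
  Δ^-quotient n f = ≐-trans (≐-sym (1-x^⊛≐Δ^ n _)) (⊛-quotient f _ (1-x^-unit n))

  -- Expansion over digit tuples and the numerator formula

  shift^-coeff-toList : ∀ t {m} (h : Vector Carrier m) →
    shift^ t (coeff (toList h)) ≐ λ k → ∑[ j < m ] ([ does (t ℕ.+ toℕ j ℕₚ.≟ k) ] h j)
  shift^-coeff-toList (suc t) {m} h zero = sym (sum-replicate-zero m)
  shift^-coeff-toList (suc t) h (suc k) = shift^-coeff-toList t h k
  shift^-coeff-toList zero {zero}  h k       = refl
  shift^-coeff-toList zero {suc m} h zero    =
    sym (trans (+-congˡ (sum-replicate-zero m)) (+-identityʳ _))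
  shift^-coeff-toList zero {suc m} h (suc k) =
    trans (shift^-coeff-toList zero (h ∘ suc) k) (sym (+-identityˡ _))

  -- Expanding `(1 + x + ... + x^(b-1))^n` means choosing one exponent, that is one digit, from each
  -- factor.
  box^-digits : ∀ b n f → box^ b n f ≐ λ k → listSum (digits b n) λ ys → shift^ (digitSum ys) f k
  box^-digits b zero    f k = sym (+-identityʳ _)
  box^-digits b (suc n) f k = begin
    ∑[ y < b ] shift^ (toℕ y) (box^ b n f) k
      ≈⟨ sum-cong-≋ {b} (λ y → trans (shift^-cong (toℕ y) (box^-digits b n f) k)
           (shift^-∑ (toℕ y) (λ i → shift^ (digitSum (List.lookup (digits b n) i)) f) k)) ⟩
    ∑[ y < b ] listSum (digits b n) (λ ys → shift^ (toℕ y) (shift^ (digitSum ys) f) k)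
      -- The product of `x^y` and `x^s` is `x^(y + s)`.
      ≈⟨ sum-cong-≋ {b} (λ y → listSum-cong (digits b n) λ ys →
           reflexive (cong (λ g → g k) (≡.sym (fold-+ f shift (toℕ y) {digitSum ys})))) ⟩
    ∑[ y < b ] listSum (digits b n) (λ ys → shift^ (toℕ y ℕ.+ digitSum ys) f k)
      ≈⟨ listSum-digits b n (λ ys → shift^ (digitSum ys) f k) ⟨
    listSum (digits b (suc n)) (λ ys → shift^ (digitSum ys) f k)
      ∎

  -- The `suc n` boxes supply one digit more than the chain has summands. Summing that digit out
  -- with the others fixed turns `j + y + s = b i + (b - 1)` into the condition that the next carry
  -- is `i`.
  decimate-box^-coeff : ∀ b .{{_ : NonZero b}} n {m} (h : Vector Carrier m) i →
    decimate b (box^ b (suc n) (coeff (toList h))) i ≈ ∑[ j < m ] (carryCount b n (toℕ j) i × h j)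
  decimate-box^-coeff b n {m} h i = begin
    box^ b (suc n) f N
      ≈⟨ box^-digits b (suc n) f N ⟩
    listSum (digits b (suc n)) (λ ys → shift^ (digitSum ys) f N)
      ≈⟨ listSum-digits b n (λ ys → shift^ (digitSum ys) f N) ⟩
    ∑[ y < b ] listSum (digits b n) (λ ys → shift^ (toℕ y ℕ.+ digitSum ys) f N)
      ≈⟨ ∑-listSum-comm (digits b n) (λ y ys → shift^ (toℕ {b} y ℕ.+ digitSum ys) f N) ⟩
    listSum (digits b n) (λ ys → ∑[ y < b ] shift^ (toℕ y ℕ.+ digitSum ys) f N)
      ≈⟨ listSum-cong (digits b n) (λ ys → first-digit (digitSum ys)) ⟩
    listSum (digits b n) (λ ys → ∑[ j < m ] ([ does (nextCarry b (toℕ j) ys ℕₚ.≟ i) ] h j))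
      ≈⟨ ∑-listSum-comm (digits b n) (λ j ys → [ does (nextCarry b (toℕ j) ys ℕₚ.≟ i) ] h j) ⟨
    ∑[ j < m ] listSum (digits b n) (λ ys → [ does (nextCarry b (toℕ j) ys ℕₚ.≟ i) ] h j)
      ≈⟨ sum-cong-≋ (λ j → listSum-filter (λ ys → nextCarry b (toℕ j) ys ℕₚ.≟ i) (digits b n) (h j)) ⟩
    ∑[ j < m ] (carryCount b n (toℕ j) i × h j)
      ∎
    where
    f = coeff (toList h)
    N = b ℕ.* i ℕ.+ (b ∸ 1)
    -- Isolates `j + s`, the column total whose quotient by `b` is the next carry.
    regroup : ∀ y s j → y ℕ.+ s ℕ.+ j ≡ y ℕ.+ (j ℕ.+ s)
    regroup y s j = ≡.trans (ℕₚ.+-assoc y s j) (cong (y ℕ.+_) (ℕₚ.+-comm s j))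
    first-digit : ∀ s → ∑[ y < b ] shift^ (toℕ y ℕ.+ s) f N
                      ≈ ∑[ j < m ] ([ does ((toℕ j ℕ.+ s) / b ℕₚ.≟ i) ] h j)
    first-digit s = begin
      ∑[ y < b ] shift^ (toℕ y ℕ.+ s) f N
        ≈⟨ sum-cong-≋ {b} (λ y → trans (shift^-coeff-toList (toℕ y ℕ.+ s) h N)
             (sum-cong-≋ λ j → reflexive
               (cong (λ t → [ does (t ℕₚ.≟ N) ] h j) (regroup (toℕ y) s (toℕ j))))) ⟩
      ∑[ y < b ] ∑[ j < m ] ([ does (toℕ y ℕ.+ (toℕ j ℕ.+ s) ℕₚ.≟ N) ] h j)
        ≈⟨ ∑-comm {b} {m} (λ y j → [ does (toℕ y ℕ.+ (toℕ j ℕ.+ s) ℕₚ.≟ N) ] h j) ⟩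
      ∑[ j < m ] ∑[ y < b ] ([ does (toℕ y ℕ.+ (toℕ j ℕ.+ s) ℕₚ.≟ N) ] h j)
        ≈⟨ sum-cong-≋ (λ j → ∑-completing-digit b (toℕ j ℕ.+ s) i (h j)) ⟩
      ∑[ j < m ] ([ does ((toℕ j ℕ.+ s) / b ℕₚ.≟ i) ] h j)
        ∎

  -- `Δ^ (suc n)` recovers the numerators from both sides of the hypothesis: `h′` directly, and `h`
  -- after `Δ^` has passed the decimation.
  numerator-carries : ∀ b .{{_ : NonZero b}} n {m} (h : Vector Carrier m) (h′ : PowerSeries) →
    Φ b (expansion (toList h /[1-x]^ suc n)) ≋ h′ /ˢ[1-x]^ suc n →
    ∀ i → h′ i ≈ ∑[ j < m ] (carryCount b n (toℕ j) i × h j)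
  numerator-carries b n h h′ eq i = begin
    h′ i
      ≈⟨ Δ^-quotient (suc n) h′ i ⟨
    Δ^ (suc n) (quotient h′ (coeff (1-x ^ᴾ suc n)) (1-x^-unit (suc n))) i
      ≈⟨ Δ^-cong (suc n) same i ⟨
    Δ^ (suc n) (decimate b e) i
      ≈⟨ Δ^-decimate b (suc n) e i ⟩
    decimate b (box^ b (suc n) (Δ^ (suc n) e)) i
      ≈⟨ box^-cong b (suc n) (Δ^-quotient (suc n) (coeff (toList h))) _ ⟩
    decimate b (box^ b (suc n) (coeff (toList h))) i
      ≈⟨ decimate-box^-coeff b n h i ⟩
    _ ∎
    where
    e = quotient (coeff (toList h)) (coeff (1-x ^ᴾ suc n)) (1-x^-unit (suc n))
    same : decimate b e ≐ quotient h′ (coeff (1-x ^ᴾ suc n)) (1-x^-unit (suc n))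
    -- The hypothesis at the integer index `+ k`, moved to natural indices; the two additions of 0
    -- come from the pole order 0 of both series.
    same k with eq (+ k)
    ... | eqₖ rewrite ≡.sym (ℤₚ.pos-* b k)
                    | ℕₚ.+-identityʳ (b ℕ.* k ℕ.+ (b ∸ 1))
                    | ℕₚ.+-identityʳ k = eqₖ

-- Rational scalars: from counts to transition probabilities

1+k/1≡[1+k]/1 : ∀ k → 1ℚ ℚ.+ (+ k ℚ./ 1) ≡ + suc k ℚ./ 1
-- Reduced fractions do not compute for a variable `k`; unnormalised ones do, and leave an integer
-- identity.
1+k/1≡[1+k]/1 k = ℚₚ.toℚᵘ-injective (begin
  ℚ.toℚᵘ (1ℚ ℚ.+ (+ k ℚ./ 1))           ≈⟨ ℚₚ.toℚᵘ-homo-+ 1ℚ (+ k ℚ./ 1) ⟩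
  ℚᵘ.1ℚᵘ ℚᵘ.+ ℚ.toℚᵘ (+ k ℚ./ 1)        ≈⟨ ℚᵘₚ.+-congʳ ℚᵘ.1ℚᵘ (ℚₚ.toℚᵘ-fromℚᵘ (mkℚᵘ (+ k) 0)) ⟩
  ℚᵘ.1ℚᵘ ℚᵘ.+ mkℚᵘ (+ k) 0              ≈⟨ *≡* (rearrange (+ k)) ⟩
  mkℚᵘ (+ suc k) 0                      ≈⟨ ℚₚ.toℚᵘ-fromℚᵘ (mkℚᵘ (+ suc k) 0) ⟨
  ℚ.toℚᵘ (+ suc k ℚ./ 1)                ∎)
  where
  open SetoidReasoning ℚᵘₚ.≃-setoid
  rearrange : ∀ k → (+ 1 ℤ.* + 1 ℤ.+ k ℤ.* + 1) ℤ.* + 1 ≡ (+ 1 ℤ.+ k) ℤ.* + 1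
  rearrange = ℤ-solve-∀

d*[k/d]≡k : ∀ d .{{_ : NonZero d}} k → (+ d ℚ./ 1) ℚ.* (+ k ℚ./ d) ≡ + k ℚ./ 1
d*[k/d]≡k d@(suc c) k = ℚₚ.toℚᵘ-injective (begin
  ℚ.toℚᵘ ((+ d ℚ./ 1) ℚ.* (+ k ℚ./ d))
    ≈⟨ ℚₚ.toℚᵘ-homo-* (+ d ℚ./ 1) (+ k ℚ./ d) ⟩
  ℚ.toℚᵘ (+ d ℚ./ 1) ℚᵘ.* ℚ.toℚᵘ (+ k ℚ./ d)
    ≈⟨ ℚᵘₚ.*-cong (ℚₚ.toℚᵘ-fromℚᵘ (mkℚᵘ (+ d) 0)) (ℚₚ.toℚᵘ-fromℚᵘ (mkℚᵘ (+ k) c)) ⟩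
  mkℚᵘ (+ d) 0 ℚᵘ.* mkℚᵘ (+ k) c
    ≈⟨ *≡* (rearrange (+ d) (+ k)) ⟩
  mkℚᵘ (+ k) 0
    ≈⟨ ℚₚ.toℚᵘ-fromℚᵘ (mkℚᵘ (+ k) 0) ⟨
  ℚ.toℚᵘ (+ k ℚ./ 1)
    ∎)
  where
  open SetoidReasoning ℚᵘₚ.≃-setoid
  rearrange : ∀ d k → (d ℤ.* k) ℤ.* + 1 ≡ k ℤ.* (+ 1 ℤ.* d)
  rearrange = ℤ-solve-∀

-- Stated for any homomorphism `ι` from the rationals, which keeps the Cauchy sequences behind `ℂ`
-- out of these calculations.
module RationalScalars {c ℓ} (R : CommutativeRing c ℓ)
  {ι : ℚ → CommutativeRing.Carrier R}
  (isHom : IsSemiringHomomorphism ℚ.+-*-rawSemiring (Semiring.rawSemiring (CommutativeRing.semiring R)) ι) where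

  open CommutativeRing R hiding (zero)
  open IsSemiringHomomorphism isHom using (+-homo; *-homo; 0#-homo; 1#-homo; ⟦⟧-cong)
  open Series R
  open CommutativeMonoidSum +-commutativeMonoid
  open MonoidMult +-monoid using (_×_)
  open SemiringSum semiring using (*-distribˡ-sum)
  open PowerSeriesOperators R using (numerator-carries)
  open SetoidReasoning setoid

  ×≈ι* : ∀ k z → k × z ≈ ι (+ k ℚ./ 1) * z
  ×≈ι* zero    z = sym (trans (*-congʳ 0#-homo) (zeroˡ z))
  ×≈ι* (suc k) z = begin
    z + k × z                            ≈⟨ +-cong (sym (trans (*-congʳ 1#-homo) (*-identityˡ z))) (×≈ι* k z) ⟩
    ι 1ℚ * z + ι (+ k ℚ./ 1) * z         ≈⟨ distribʳ z (ι 1ℚ) (ι (+ k ℚ./ 1)) ⟨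
    (ι 1ℚ + ι (+ k ℚ./ 1)) * z           ≈⟨ *-congʳ (+-homo 1ℚ (+ k ℚ./ 1)) ⟨
    ι (1ℚ ℚ.+ (+ k ℚ./ 1)) * z           ≈⟨ *-congʳ (⟦⟧-cong (1+k/1≡[1+k]/1 k)) ⟩
    ι (+ suc k ℚ./ 1) * z                ∎

  -- The factor `b ^ m` cancels the denominator of `K b m j i`.
  carryCount×≈b^m*K* : ∀ b .{{_ : NonZero b}} m j i z →
    carryCount b m j i × z ≈ ι (+ (b ^ m) ℚ./ 1) * (ι (K b m j i) * z)
  carryCount×≈b^m*K* b m j i z = begin
    count × z                                        ≈⟨ ×≈ι* count z ⟩
    ι (+ count ℚ./ 1) * z                            ≈⟨ *-congʳ (⟦⟧-cong (d*[k/d]≡k (b ^ m) {{ℕₚ.m^n≢0 b m}} count)) ⟨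
    ι ((+ (b ^ m) ℚ./ 1) ℚ.* K b m j i) * z          ≈⟨ *-congʳ (*-homo (+ (b ^ m) ℚ./ 1) (K b m j i)) ⟩
    ι (+ (b ^ m) ℚ./ 1) * ι (K b m j i) * z          ≈⟨ *-assoc _ _ z ⟩
    ι (+ (b ^ m) ℚ./ 1) * (ι (K b m j i) * z)        ∎
    where count = carryCount b m j i

  weightedSum : ∀ {m} → (Fin m → ℚ) → Vector Carrier m → Carrier
  weightedSum {m} w h = ∑[ j < m ] (ι (w j) * h j)

  numerator-K : ∀ b n .{{_ : NonZero b}} → 2 ≤ n → (h : Vector Carrier (n ∸ 1)) (h′ : PowerSeries) →
    Φ b (expansion (toList h /[1-x]^ n)) ≋ h′ /ˢ[1-x]^ n →
    ∀ i → h′ i ≈ ι (+ (b ^ (n ∸ 1)) ℚ./ 1) * weightedSum (λ j → K b (n ∸ 1) (toℕ j) i) h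
  numerator-K b (suc m) _ h h′ eq i = begin
    h′ i
      ≈⟨ numerator-carries b m h h′ eq i ⟩
    ∑[ j < m ] (carryCount b m (toℕ j) i × h j)
      ≈⟨ sum-cong-≋ (λ j → carryCount×≈b^m*K* b m (toℕ j) i (h j)) ⟩
    ∑[ j < m ] (ι (+ (b ^ m) ℚ./ 1) * (ι (K b m (toℕ j) i) * h j))
      ≈⟨ *-distribˡ-sum (ι (+ (b ^ m) ℚ./ 1)) (λ j → ι (K b m (toℕ j) i) * h j) ⟨
    ι (+ (b ^ m) ℚ./ 1) * weightedSum (λ j → K b m (toℕ j) i) h
      ∎

-- Specialisation to the complex numbers

open import Defs using (_≋_; Φ; expansion; _/[1-x]^_; _/ˢ[1-x]^_; sum-syntax)
open CommutativeRing ℂ-commutativeRing using () renaming (_+_ to _+ℂ_)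

ℚ→ℂ-+ : ∀ p q → ℚ→ℂ (p ℚ.+ q) ≈ℂ ℚ→ℂ p +ℂ ℚ→ℂ q
ℚ→ℂ-+ p q = mk≈ (ℝ-Properties.const-∼ (p ℚ.+ q)) , mk≈ (ℝ-Properties.const-∼ 0ℚ)

-- All sequences involved are constant, so equations in `ℚ` suffice; they remove the products with
-- the zero imaginary parts.
ℚ→ℂ-* : ∀ p q → ℚ→ℂ (p ℚ.* q) ≈ℂ ℚ→ℂ p *ℂ ℚ→ℂ q
ℚ→ℂ-* p q = mk≈ (const-∼-≡ re) , mk≈ (const-∼-≡ im)
  where
  const-∼-≡ : ∀ {r s} → s ≡ r → (λ _ → r) ∼ (λ _ → s)
  const-∼-≡ {r} ≡.refl = ℝ-Properties.const-∼ r
  re : p ℚ.* q ℚ.- 0ℚ ℚ.* 0ℚ ≡ p ℚ.* q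
  re = ℚₚ.+-identityʳ (p ℚ.* q)
  im : p ℚ.* 0ℚ ℚ.+ 0ℚ ℚ.* q ≡ 0ℚ
  im = cong₂ ℚ._+_ (ℚₚ.*-zeroʳ p) (ℚₚ.*-zeroˡ q)

ℚ→ℂ-isSemiringHomomorphism : IsSemiringHomomorphism ℚ.+-*-rawSemiring
  (Semiring.rawSemiring (CommutativeRing.semiring ℂ-commutativeRing)) ℚ→ℂ
ℚ→ℂ-isSemiringHomomorphism = record
  { isNearSemiringHomomorphism = record
    { +-isMonoidHomomorphism = record
      { isMagmaHomomorphism = record
        { isRelHomomorphism = record
          { cong = λ p≡q → CommutativeRing.reflexive ℂ-commutativeRing (cong ℚ→ℂ p≡q) }
        ; homo = ℚ→ℂ-+
        }
      ; ε-homo = CommutativeRing.refl ℂ-commutativeRing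
      }
    ; *-homo = ℚ→ℂ-*
    }
  ; 1#-homo = CommutativeRing.refl ℂ-commutativeRing
  }

-- Two names for an operation of ℂ are compared by unfolding them down to the proofs stored
-- in real numbers, which is only feasible in small terms.  So factors are exchanged one by
-- one, along equations about variables w and h.
weightedSum≡∑ : ∀ {m} (w : Fin m → ℚ) (h : Vector ℂ m) →
  RationalScalars.weightedSum ℂ-commutativeRing ℚ→ℂ-isSemiringHomomorphism w h ≡ ∑[ j < m ] (ℚ→ℂ (w j) *ℂ h j)
weightedSum≡∑ w h = ≡.refl

rewrite-factors : ∀ k m (w : Fin m → ℚ) (h : Vector ℂ m) z {a s} →
  a ≡ ℕ→ℂ k → s ≡ ∑[ j < m ] (ℚ→ℂ (w j) *ℂ h j) →
  z ≈ℂ a *ℂ s → z ≈ℂ ℕ→ℂ k *ℂ ∑[ j < m ] (ℚ→ℂ (w j) *ℂ h j)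
rewrite-factors k m w h z ≡.refl ≡.refl eq = eq

theorem2p1 : (b n : ℕ) .{{_ : NonZero b}} → 2 ≤ n →
    (h : Vector ℂ (n ∸ 1)) (h′ : ℕ → ℂ) →
    Φ b (expansion (toList h /[1-x]^ n)) ≋ h′ /ˢ[1-x]^ n →
    ∀ i → h′ i ≈ℂ ℕ→ℂ (b ^ (n ∸ 1)) *ℂ ∑[ j < n ∸ 1 ] (ℚ→ℂ (K b (n ∸ 1) (toℕ j) i) *ℂ h j)
theorem2p1 b n 2≤n h h′ eq i = rewrite-factors (b ^ (n ∸ 1)) (n ∸ 1) (λ j → K b (n ∸ 1) (toℕ j) i) h (h′ i)
  {ℚ→ℂ (+ (b ^ (n ∸ 1)) ℚ./ 1)} ≡.refl (weightedSum≡∑ (λ j → K b (n ∸ 1) (toℕ j) i) h)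
  (RationalScalars.numerator-K ℂ-commutativeRing ℚ→ℂ-isSemiringHomomorphism b n 2≤n h h′ eq i)
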